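{- Let $f:\{0,1\}^n\to\{\pm1\}$ be computed by a decision tree of size $s$. Then $\mathrm{Inf}(f)\le \mathrm{Var}(f)\log(4s/\mathrm{Var}(f))$, where the right-hand side is interpreted as $0$ when $\mathrm{Var}(f)=0$.
   Context: Size = number of leaves; logarithms base 2. $\mathrm{Inf}(f)=\sum_{i=1}^n\Pr_{\mathbf{x}}[f(\mathbf{x})\ne f(\mathbf{x}^{\oplus i})]$ for $\mathbf{x}$ uniform on $\{0,1\}^n$, $\mathbf{x}^{\oplus i}$ being $\mathbf{x}$ with coordinate $i$ flipped. $\mathrm{Var}(f)=4\Pr[f(\mathbf{x})=-1]\Pr[f(\mathbf{x})=1]$. -}

module Defs where

open import Data.Bool using (Bool; true; false; not; if_then_else_)
open import Data.Nat as ℕ using (ℕ; zero; suc)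
open import Data.Nat.Properties using (m^n≢0)
open import Data.Integer as ℤ using (ℤ; +_; -[1+_])
open import Data.Rational as ℚ using (ℚ; 0ℚ; 1ℚ; _/_; ↥_; ↧ₙ_)
open import Data.Fin using (Fin)
open import Data.Vec using (Vec; []; _∷_; lookup; updateAt)
open import Data.List using (List; []; _∷_; _++_; map; length; filter; foldr; allFin)
open import Data.Sign using (Sign) renaming (_≟_ to _≟ˢ_)
open import Relation.Nullary.Decidable using (⌊_⌋)

------------------------------------------------------------------------
-- Inputs {0,1}^n and Boolean functions with values in {±1}
-- (Sign.+ stands for +1, Sign.- for -1)

Input : ℕ → Set
Input n = Vec Bool n

BoolFun : ℕ → Set
BoolFun n = Input n → Sign

-- x^{⊕i}: x with coordinate i flipped
flipAt : ∀ {n} → Fin n → Input n → Input n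
flipAt i x = updateAt x i not

-- enumeration of all of {0,1}^n
allInputs : (n : ℕ) → List (Input n)
allInputs zero = [] ∷ []
allInputs (suc n) = map (false ∷_) (allInputs n) ++ map (true ∷_) (allInputs n)

-- Pr_x[P x] for x uniform on {0,1}^n, P a Boolean-valued predicate
Pr : ∀ {n} → (Input n → Bool) → ℚ
Pr {n} P = (+ length (filter (λ x → P x Data.Bool.≟ true) (allInputs n))) / (2 ℕ.^ n)
  where instance _ = m^n≢0 2 n

sumℚ : List ℚ → ℚ
sumℚ = foldr ℚ._+_ 0ℚ

-- total influence  Inf(f) = Σ_i Pr_x[f(x) ≠ f(x^{⊕i})]
Inf : ∀ {n} → BoolFun n → ℚ
Inf {n} f = sumℚ (map (λ i → Pr (λ x → not ⌊ f x ≟ˢ f (flipAt i x) ⌋)) (allFin n))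

-- Var(f) = 4 Pr[f(x) = -1] Pr[f(x) = 1]
Var : ∀ {n} → BoolFun n → ℚ
Var f = ((+ 4) / 1) ℚ.* (Pr (λ x → ⌊ f x ≟ˢ Sign.- ⌋) ℚ.* Pr (λ x → ⌊ f x ≟ˢ Sign.+ ⌋))

------------------------------------------------------------------------
-- Decision trees over x ∈ {0,1}^n with leaves labelled ±1

data DTree (n : ℕ) : Set where
  leaf : Sign → DTree n
  -- query x_i; go to the first subtree if x_i = 0, the second if x_i = 1
  node : Fin n → DTree n → DTree n → DTree n

eval : ∀ {n} → DTree n → Input n → Sign
eval (leaf b) x = b
eval (node i t₀ t₁) x = if lookup x i then eval t₁ x else eval t₀ x

-- size = number of leaves
size : ∀ {n} → DTree n → ℕ
size (leaf _) = 1
size (node _ t₀ t₁) = size t₀ ℕ.+ size t₁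

Computes : ∀ {n} → DTree n → BoolFun n → Set
Computes T f = ∀ x → eval T x ≡ f x
  where open import Relation.Binary.PropositionalEquality using (_≡_)

------------------------------------------------------------------------
-- Base-2 logarithm, expressed through its defining order relation.
-- There are no reals in agda-stdlib; for a rational r and a positive
-- rational y, "r ≤ log₂ y" means 2^r ≤ y.  Writing r = p/q in lowest
-- terms (q ≥ 1), this is 2^p ≤ y^q (exact, as t ↦ t^q is monotone on
-- positives).

_^ℚ_ : ℚ → ℕ → ℚ
y ^ℚ zero = 1ℚ
y ^ℚ suc k = y ℚ.* (y ^ℚ k)

-- 2^p for an integer p, as a rational
pow2ℤ : ℤ → ℚ
pow2ℤ (+ k) = (+ (2 ℕ.^ k)) / 1
pow2ℤ -[1+ k ] = (+ 1) / (2 ℕ.^ suc k)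
  where instance _ = m^n≢0 2 (suc k)

-- r ≤ log₂ y
_≤log₂_ : ℚ → ℚ → Set
r ≤log₂ y = pow2ℤ (↥ r) ℚ.≤ (y ^ℚ (↧ₙ r))

module Submission where

-- Inf(f) ≤ Var(f) · log₂(4s / Var(f)) for f computed by a decision tree T with s leaves.
--
-- Let N = 2ⁿ, M = #{f = -1}, P = #{f = +1} (so N²·Var = 4MP), and C = N·Inf(f), the number of
-- pairs (i, x) with f(x) ≠ f(x^{⊕i}).  For an input x let d(x) be the number of distinct
-- coordinates queried on its path, and for a sign σ let A_σ = ∑_{f(x)=σ} d(x).
--  (1) Every coordinate f is sensitive to at x is queried on the path of x, and every
--      sensitive edge has exactly one endpoint with value σ; hence C ≤ 2A_σ.
--  (2) Kraft: ∑ₓ 2^{d(x)} ≤ sN.  With AM-GM over the M σ-inputs (σ = -): M^M 2^{A_σ} ≤ (sN)^M,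
--      and likewise for σ = + with P.
--  (3) Arithmetic turns (1) and (2) for the minority sign into 2^{CN}(MP)^{4MP} ≤ (sN²)^{4MP},
--      i.e. 2^{Inf/Var} ≤ 4s/Var, which is the definition of  Inf/Var ≤ log₂(4s/Var).
-- If Var = 0 then f is constant and Inf = 0.
-- Modules: Arithmetic (AM-GM and step (3)); FiniteSums (sums over lists, the cube and Fin n);
-- DecisionTreePaths (queried coordinates, sensitivity, Kraft); Sensitivity (steps (1), (2) for
-- a fixed f); RationalEmbedding and Scaled (reducing the rational statement to integers).

open import Defs
open import Data.Nat using (ℕ)

-- Inequalities between natural numbers: AM-GM and the arithmetic core of the theorem.
module Arithmetic where

  open import Data.Nat
  open import Data.Nat.Properties
  open import Data.Nat.Tactic.RingSolver using (solve-∀)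
  open import Data.List using ([]; _∷_; length)
  open import Data.Nat.ListAction using (sum; product)
  open import Data.Sum using (inj₁; inj₂)
  open import Relation.Binary.PropositionalEquality
  open ≤-Reasoning

  -- Powers distribute over products.
  ^-distribʳ-* : ∀ a b k → (a * b) ^ k ≡ a ^ k * b ^ k
  ^-distribʳ-* a b zero = refl
  ^-distribʳ-* a b (suc k) = begin-equality
    a * b * (a * b) ^ k     ≡⟨ cong (a * b *_) (^-distribʳ-* a b k) ⟩
    a * b * (a ^ k * b ^ k) ≡⟨ interchange a b (a ^ k) (b ^ k) ⟩
    a * a ^ k * (b * b ^ k) ∎
    where
    interchange : ∀ a b u v → a * b * (u * v) ≡ a * u * (b * v)
    interchange = solve-∀

  -- The two-variable AM-GM inequality  2xy ≤ x² + y²  (first for x ≤ y, then by symmetry).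
  2xy≤x²+y²-ordered : ∀ x d → 2 * x * (x + d) ≤ x * x + (x + d) * (x + d)
  2xy≤x²+y²-ordered x d = ≤-trans (m≤m+n _ (d * d)) (≤-reflexive (expand x d))
    where
    expand : ∀ x d → 2 * x * (x + d) + d * d ≡ x * x + (x + d) * (x + d)
    expand = solve-∀

  2xy≤x²+y² : ∀ x y → 2 * x * y ≤ x * x + y * y
  2xy≤x²+y² x y with ≤-total x y
  ... | inj₁ x≤y = subst (λ z → 2 * x * z ≤ x * x + z * z) (m+[n∸m]≡n x≤y) (2xy≤x²+y²-ordered x (y ∸ x))
  ... | inj₂ y≤x = subst₂ _≤_ (swap y x) (+-comm (y * y) (x * x))
                     (subst (λ z → 2 * y * z ≤ y * y + z * z) (m+[n∸m]≡n y≤x) (2xy≤x²+y²-ordered y (x ∸ y)))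
    where
    swap : ∀ a b → 2 * a * b ≡ 2 * b * a
    swap = solve-∀

  -- Bernoulli-type inequality, the weighted two-term AM-GM:
  --   (k+1) x yᵏ ≤ xᵏ⁺¹ + k yᵏ⁺¹.
  -- Induction on k, using 2xy ≤ x² + y² to absorb one more factor.
  bernoulli : ∀ k x y → suc k * x * y ^ k ≤ x ^ suc k + k * y ^ suc k
  bernoulli zero x y = ≤-reflexive (base x)
    where
    base : ∀ x → 1 * x * 1 ≡ x * 1 + 0
    base = solve-∀
  bernoulli (suc k) x y = +-cancelʳ-≤ (k * x * y ^ suc k) _ _ (begin
    suc (suc k) * x * (y * u) + k * x * (y * u)   ≡⟨ regroup₁ k x y u ⟩
    suc k * u * (2 * x * y)                        ≤⟨ *-monoʳ-≤ (suc k * u) (2xy≤x²+y² x y) ⟩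
    suc k * u * (x * x + y * y)                    ≡⟨ regroup₂ k x y u ⟩
    suc k * x * u * x + suc k * (y * (y * u))      ≤⟨ +-monoˡ-≤ _ (*-monoˡ-≤ x (bernoulli k x y)) ⟩
    (x ^ suc k + k * (y * u)) * x + suc k * (y * (y * u))
                                                   ≡⟨ regroup₃ k x y u (x ^ suc k) ⟩
    x * x ^ suc k + suc k * (y * (y * u)) + k * x * (y * u) ∎)
    where
    u : ℕ
    u = y ^ k
    regroup₁ : ∀ k x y u → suc (suc k) * x * (y * u) + k * x * (y * u) ≡ suc k * u * (2 * x * y)
    regroup₁ = solve-∀
    regroup₂ : ∀ k x y u → suc k * u * (x * x + y * y) ≡ suc k * x * u * x + suc k * (y * (y * u))
    regroup₂ = solve-∀
    regroup₃ : ∀ k x y u p → (p + k * (y * u)) * x + suc k * (y * (y * u))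
                             ≡ x * p + suc k * (y * (y * u)) + k * x * (y * u)
    regroup₃ = solve-∀

  -- The inductive step of AM-GM: adding a term a to m terms of sum S,
  --   (m+1)ᵐ⁺¹ a Sᵐ ≤ mᵐ (a + S)ᵐ⁺¹,
  -- i.e. Bernoulli's inequality at x = m(a+S), y = (m+1)S, divided by m.
  am-gm-step : ∀ m a S → suc m ^ suc m * a * S ^ m ≤ m ^ m * (a + S) ^ suc m
  am-gm-step zero a S = subst₂ _≤_ (lhs a) (rhs a S) (m≤m+n a S)
    where
    lhs : ∀ a → a ≡ 1 * 1 * a * 1
    lhs = solve-∀
    rhs : ∀ a S → a + S ≡ 1 * ((a + S) * 1)
    rhs = solve-∀
  am-gm-step m@(suc _) a S = *-cancelˡ-≤ m (+-cancelʳ-≤ (m * (Y * Ym)) _ _ (begin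
    m * (suc m ^ suc m * a * S ^ m) + m * (Y * Ym)  ≡⟨ regroup₁ m a S (suc m ^ m) (S ^ m) ⟩
    suc m * X * Ym                                   ≡⟨ cong (λ z → suc m * X * z) (sym (^-distribʳ-* (suc m) S m)) ⟩
    suc m * X * Y ^ m                                ≤⟨ bernoulli m X Y ⟩
    X ^ suc m + m * Y ^ suc m                        ≡⟨ cong₂ _+_ (^-distribʳ-* m (a + S) (suc m)) (cong (λ z → m * (Y * z)) (^-distribʳ-* (suc m) S m)) ⟩
    m * m ^ m * (a + S) ^ suc m + m * (Y * Ym)       ≡⟨ cong (_+ m * (Y * Ym)) (*-assoc m (m ^ m) _) ⟩
    m * (m ^ m * (a + S) ^ suc m) + m * (Y * Ym)     ∎))
    where
    X Y Ym : ℕ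
    X = m * (a + S)
    Y = suc m * S
    Ym = suc m ^ m * S ^ m
    regroup₁ : ∀ m a S p q → m * (suc m * p * a * q) + m * (suc m * S * (p * q))
                            ≡ suc m * (m * (a + S)) * (p * q)
    regroup₁ = solve-∀

  -- AM-GM for a list of naturals of length m:  mᵐ · ∏ L ≤ (∑ L)ᵐ.
  am-gm : ∀ L → length L ^ length L * product L ≤ sum L ^ length L
  am-gm [] = ≤-refl
  am-gm (a ∷ R) = *-cancelˡ-≤ (m ^ m) {{m^m≢0 m}} (begin
    m ^ m * (suc m ^ suc m * (a * product R)) ≡⟨ regroup (suc m ^ suc m) (m ^ m) a (product R) ⟩
    suc m ^ suc m * a * (m ^ m * product R)   ≤⟨ *-monoʳ-≤ (suc m ^ suc m * a) (am-gm R) ⟩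
    suc m ^ suc m * a * sum R ^ m             ≤⟨ am-gm-step m a (sum R) ⟩
    m ^ m * (a + sum R) ^ suc m               ∎)
    where
    m : ℕ
    m = length R
    m^m≢0 : ∀ m → NonZero (m ^ m)
    m^m≢0 zero = _
    m^m≢0 m@(suc _) = m^n≢0 m m
    regroup : ∀ A B a P → B * (A * (a * P)) ≡ A * a * (B * P)
    regroup = solve-∀

  -- Taking E-th roots is monotone on ℕ.
  ^-cancelˡ-≤ : ∀ E .{{_ : NonZero E}} {u w} → u ^ E ≤ w ^ E → u ≤ w
  ^-cancelˡ-≤ E uᴱ≤wᴱ = ≮⇒≥ (λ w<u → <⇒≱ (^-monoˡ-< E w<u) uᴱ≤wᴱ)

  -- Rescaling an exponential inequality: if 2ᵃ Fᴱ ≤ Gᴱ and p/q = a/E, then 2ᵖ F^q ≤ G^q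
  -- (raise both sides to the q-th power, then take E-th roots).
  exponent-rescale : ∀ {a E F G} p q .{{_ : NonZero E}} → p * E ≡ q * a →
                     2 ^ a * F ^ E ≤ G ^ E → 2 ^ p * F ^ q ≤ G ^ q
  exponent-rescale {a} {E} {F} {G} p q pE≡qa 2ᵃFᴱ≤Gᴱ = ^-cancelˡ-≤ E (begin
    (2 ^ p * F ^ q) ^ E         ≡⟨ ^-distribʳ-* (2 ^ p) (F ^ q) E ⟩
    (2 ^ p) ^ E * (F ^ q) ^ E   ≡⟨ cong₂ _*_ (^-*-assoc 2 p E) (^-*-assoc F q E) ⟩
    2 ^ (p * E) * F ^ (q * E)   ≡⟨ cong₂ (λ i j → 2 ^ i * F ^ j) (trans pE≡qa (*-comm q a)) (*-comm q E) ⟩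
    2 ^ (a * q) * F ^ (E * q)   ≡⟨ sym (cong₂ _*_ (^-*-assoc 2 a q) (^-*-assoc F E q)) ⟩
    (2 ^ a) ^ q * (F ^ E) ^ q   ≡⟨ sym (^-distribʳ-* (2 ^ a) (F ^ E) q) ⟩
    (2 ^ a * F ^ E) ^ q         ≤⟨ ^-monoˡ-≤ q 2ᵃFᴱ≤Gᴱ ⟩
    (G ^ E) ^ q                 ≡⟨ ^-*-assoc G E q ⟩
    G ^ (E * q)                 ≡⟨ cong (G ^_) (*-comm E q) ⟩
    G ^ (q * E)                 ≡⟨ sym (^-*-assoc G q E) ⟩
    (G ^ q) ^ E                 ∎)

  -- Multiplying both bases of  2ᵃ Fᴱ ≤ Gᴱ  by the same factor k preserves it.
  scale-bases : ∀ k {a E F G} → 2 ^ a * F ^ E ≤ G ^ E → 2 ^ a * (k * F) ^ E ≤ (k * G) ^ E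
  scale-bases k {a} {E} {F} {G} 2ᵃFᴱ≤Gᴱ = begin
    2 ^ a * (k * F) ^ E         ≡⟨ cong (2 ^ a *_) (^-distribʳ-* k F E) ⟩
    2 ^ a * (k ^ E * F ^ E)     ≡⟨ x*[y*z]≡y*[x*z] (2 ^ a) (k ^ E) (F ^ E) ⟩
    k ^ E * (2 ^ a * F ^ E)     ≤⟨ *-monoʳ-≤ (k ^ E) 2ᵃFᴱ≤Gᴱ ⟩
    k ^ E * G ^ E               ≡⟨ sym (^-distribʳ-* k G E) ⟩
    (k * G) ^ E                 ∎
    where
    x*[y*z]≡y*[x*z] : ∀ x y z → x * (y * z) ≡ y * (x * z)
    x*[y*z]≡y*[x*z] = solve-∀

  -- From  Mᴹ 2ᴬ ≤ Xᴹ  and  C ≤ 2A,  raising to the power 2N:  2^{CN} M^{2MN} ≤ X^{2MN}.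
  entropy-power : ∀ {M A C X} N → C ≤ 2 * A → M ^ M * 2 ^ A ≤ X ^ M →
                  2 ^ (C * N) * M ^ (2 * M * N) ≤ X ^ (2 * M * N)
  entropy-power {M} {A} {C} {X} N C≤2A MᴹA≤Xᴹ = begin
    2 ^ (C * N) * M ^ (2 * M * N)           ≤⟨ *-monoˡ-≤ _ (^-monoʳ-≤ 2 (*-monoˡ-≤ N C≤2A)) ⟩
    2 ^ (2 * A * N) * M ^ (2 * M * N)       ≡⟨ cong₂ (λ i j → 2 ^ i * M ^ j) (split A N) (split M N) ⟩
    2 ^ (A * (2 * N)) * M ^ (M * (2 * N))   ≡⟨ sym (cong₂ _*_ (^-*-assoc 2 A (2 * N)) (^-*-assoc M M (2 * N))) ⟩
    (2 ^ A) ^ (2 * N) * (M ^ M) ^ (2 * N)   ≡⟨ *-comm _ ((M ^ M) ^ (2 * N)) ⟩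
    (M ^ M) ^ (2 * N) * (2 ^ A) ^ (2 * N)   ≡⟨ sym (^-distribʳ-* (M ^ M) (2 ^ A) (2 * N)) ⟩
    (M ^ M * 2 ^ A) ^ (2 * N)               ≤⟨ ^-monoˡ-≤ (2 * N) MᴹA≤Xᴹ ⟩
    (X ^ M) ^ (2 * N)                       ≡⟨ ^-*-assoc X M (2 * N) ⟩
    X ^ (M * (2 * N))                       ≡⟨ cong (X ^_) (sym (split M N)) ⟩
    X ^ (2 * M * N)                         ∎
    where
    split : ∀ m N → 2 * m * N ≡ m * (2 * N)
    split = solve-∀

  -- The arithmetic heart of the theorem.  Let M ≤ P with M + P = N, s ≥ 1, Mᴹ 2ᴬ ≤ (sN)ᴹ and
  -- C ≤ 2A.  Then with E = 4MP:  2^{CN} (MP)ᴱ ≤ (sN²)ᴱ,  i.e. 2^{CN/4MP} ≤ sN²/MP.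
  -- Write E = 2MN + e (possible as M ≤ P): the 2MN part is entropy-power, and the remaining
  -- factors are bounded using M, P ≤ N and s ≥ 1.
  spread-bound : ∀ {M P N s A C} .{{_ : NonZero s}} → M + P ≡ N → M ≤ P → C ≤ 2 * A →
                 M ^ M * 2 ^ A ≤ (s * N) ^ M →
                 2 ^ (C * N) * (M * P) ^ (4 * (M * P)) ≤ (s * (N * N)) ^ (4 * (M * P))
  spread-bound {M} {P} {N} {s} {A} {C} M+P≡N M≤P C≤2A MᴹA≤sNᴹ = begin
    2 ^ (C * N) * (M * P) ^ E               ≡⟨ cong (2 ^ (C * N) *_) (^-distribʳ-* M P E) ⟩
    2 ^ (C * N) * (M ^ E * P ^ E)           ≡⟨ cong (λ j → 2 ^ (C * N) * (M ^ j * P ^ E)) (sym K+e≡E) ⟩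
    2 ^ (C * N) * (M ^ (K + e) * P ^ E)     ≡⟨ cong (λ z → 2 ^ (C * N) * (z * P ^ E)) (^-distribˡ-+-* M K e) ⟩
    2 ^ (C * N) * (M ^ K * M ^ e * P ^ E)   ≡⟨ regroup₁ (2 ^ (C * N)) (M ^ K) (M ^ e) (P ^ E) ⟩
    2 ^ (C * N) * M ^ K * (M ^ e * P ^ E)   ≤⟨ *-mono-≤ (entropy-power {M} {A} {C} {s * N} N C≤2A MᴹA≤sNᴹ)
                                                          (*-mono-≤ (^-monoˡ-≤ e M≤N) (^-monoˡ-≤ E P≤N)) ⟩
    (s * N) ^ K * (N ^ e * N ^ E)           ≡⟨ cong (_* (N ^ e * N ^ E)) (^-distribʳ-* s N K) ⟩
    s ^ K * N ^ K * (N ^ e * N ^ E)         ≡⟨ regroup₂ (s ^ K) (N ^ K) (N ^ e) (N ^ E) ⟩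
    s ^ K * (N ^ K * N ^ e) * N ^ E         ≡⟨ cong (λ z → s ^ K * z * N ^ E) (sym (^-distribˡ-+-* N K e)) ⟩
    s ^ K * N ^ (K + e) * N ^ E             ≡⟨ cong (λ j → s ^ K * N ^ j * N ^ E) K+e≡E ⟩
    s ^ K * N ^ E * N ^ E                   ≤⟨ *-monoˡ-≤ (N ^ E) (*-monoˡ-≤ (N ^ E) (^-monoʳ-≤ s K≤E)) ⟩
    s ^ E * N ^ E * N ^ E                   ≡⟨ *-assoc (s ^ E) (N ^ E) (N ^ E) ⟩
    s ^ E * (N ^ E * N ^ E)                 ≡⟨ cong (s ^ E *_) (sym (^-distribʳ-* N N E)) ⟩
    s ^ E * (N * N) ^ E                     ≡⟨ sym (^-distribʳ-* s (N * N) E) ⟩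
    (s * (N * N)) ^ E                       ∎
    where
    E K : ℕ
    E = 4 * (M * P)
    K = 2 * M * N
    M≤N : M ≤ N
    M≤N = subst (M ≤_) M+P≡N (m≤m+n M P)
    P≤N : P ≤ N
    P≤N = subst (P ≤_) M+P≡N (m≤n+m P M)
    K≤E : K ≤ E
    K≤E = begin
      2 * M * N       ≡⟨ cong (2 * M *_) (sym M+P≡N) ⟩
      2 * M * (M + P) ≤⟨ *-monoʳ-≤ (2 * M) (+-monoˡ-≤ P M≤P) ⟩
      2 * M * (P + P) ≡⟨ double M P ⟩
      4 * (M * P)     ∎
      where
      double : ∀ M P → 2 * M * (P + P) ≡ 4 * (M * P)
      double = solve-∀
    e : ℕ
    e = E ∸ K
    K+e≡E : K + e ≡ E
    K+e≡E = m+[n∸m]≡n K≤E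
    regroup₁ : ∀ a b c d → a * (b * c * d) ≡ a * b * (c * d)
    regroup₁ = solve-∀
    regroup₂ : ∀ a b c d → a * b * (c * d) ≡ a * (b * c) * d
    regroup₂ = solve-∀

  -- The same bound without knowing which of M, P is smaller: apply spread-bound to the smaller one.
  spread-bound-either : ∀ {M P N s A B C} .{{_ : NonZero s}} → M + P ≡ N →
                        C ≤ 2 * A → M ^ M * 2 ^ A ≤ (s * N) ^ M →
                        C ≤ 2 * B → P ^ P * 2 ^ B ≤ (s * N) ^ P →
                        2 ^ (C * N) * (M * P) ^ (4 * (M * P)) ≤ (s * (N * N)) ^ (4 * (M * P))
  spread-bound-either {M} {P} {N} {s} {A} {B} {C} M+P≡N C≤2A Mᴹ2ᴬ≤ C≤2B Pᴾ2ᴮ≤ with ≤-total M P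
  ... | inj₁ M≤P = spread-bound {A = A} M+P≡N M≤P C≤2A Mᴹ2ᴬ≤
  ... | inj₂ P≤M = subst (λ z → 2 ^ (C * N) * z ^ (4 * z) ≤ (s * (N * N)) ^ (4 * z)) (*-comm P M)
                         (spread-bound {A = B} (trans (+-comm P M) M+P≡N) P≤M C≤2B Pᴾ2ᴮ≤)


-- Finite sums ∑_{x ∈ xs} h(x) over lists, in particular over the cube {0,1}ⁿ and over Fin n,
-- and the symmetries of the cube given by flipping a coordinate.
module FiniteSums where

  open Arithmetic using (am-gm)
  open import Data.Bool using (Bool; true; false; not) renaming (_≟_ to _≟ᵇ_)
  open import Data.Bool.Properties using (not-involutive)
  open import Data.Nat
  open import Data.Nat.Properties
  open import Algebra.Properties.CommutativeSemigroup +-commutativeSemigroup using (interchange)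
  open import Data.Nat.ListAction using (sum; product)
  open import Data.Nat.ListAction.Properties using (sum-++)
  open import Data.Fin using (Fin; zero; suc) renaming (_≟_ to _≟ᶠ_)
  open import Data.Vec using (_∷_; lookup)
  open import Data.Vec.Properties using (lookup∘updateAt; lookup∘updateAt′; updateAt-updateAt; updateAt-id-local)
  open import Data.List using (List; []; _∷_; _++_; map; length; filter; allFin)
  open import Data.List.Properties using (map-++; map-cong; map-∘; map-tabulate; length-map)
  open import Function using (_∘_)
  open import Relation.Binary.PropositionalEquality
  open import Relation.Nullary using (yes; no)
  open import Relation.Nullary.Decidable using (⌊_⌋)

  private variable
    A B : Set
    n : ℕ

  -- Indicator of a Boolean.
  ind : Bool → ℕ
  ind true = 1
  ind false = 0

  -- ∑ xs h  =  ∑_{x ∈ xs} h(x).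
  ∑ : List A → (A → ℕ) → ℕ
  ∑ xs h = sum (map h xs)

  ∑-cong : ∀ (xs : List A) {h g : A → ℕ} → (∀ x → h x ≡ g x) → ∑ xs h ≡ ∑ xs g
  ∑-cong xs h≗g = cong sum (map-cong h≗g xs)

  ∑-mono : ∀ (xs : List A) {h g : A → ℕ} → (∀ x → h x ≤ g x) → ∑ xs h ≤ ∑ xs g
  ∑-mono [] h≤g = z≤n
  ∑-mono (x ∷ xs) h≤g = +-mono-≤ (h≤g x) (∑-mono xs h≤g)

  ∑-+ : ∀ (xs : List A) (h g : A → ℕ) → ∑ xs (λ x → h x + g x) ≡ ∑ xs h + ∑ xs g
  ∑-+ [] h g = refl
  ∑-+ (x ∷ xs) h g rewrite ∑-+ xs h g = interchange (h x) (g x) (∑ xs h) (∑ xs g)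

  ∑-* : ∀ (xs : List A) k (h : A → ℕ) → ∑ xs (λ x → k * h x) ≡ k * ∑ xs h
  ∑-* [] k h = sym (*-zeroʳ k)
  ∑-* (x ∷ xs) k h rewrite ∑-* xs k h = sym (*-distribˡ-+ k (h x) (∑ xs h))

  ∑-zero : ∀ (xs : List A) → ∑ xs (λ _ → 0) ≡ 0
  ∑-zero [] = refl
  ∑-zero (x ∷ xs) = ∑-zero xs

  ∑-++ : ∀ (xs ys : List A) h → ∑ (xs ++ ys) h ≡ ∑ xs h + ∑ ys h
  ∑-++ xs ys h = trans (cong sum (map-++ h xs ys)) (sum-++ (map h xs) (map h ys))

  ∑-map : ∀ (xs : List A) (g : A → B) h → ∑ (map g xs) h ≡ ∑ xs (h ∘ g)
  ∑-map xs g h = cong sum (sym (map-∘ xs))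

  -- Fubini for finite sums.
  ∑-swap : ∀ (xs : List A) (ys : List B) (h : A → B → ℕ) →
           ∑ xs (λ x → ∑ ys (h x)) ≡ ∑ ys (λ y → ∑ xs (λ x → h x y))
  ∑-swap [] ys h = sym (∑-zero ys)
  ∑-swap (x ∷ xs) ys h = trans (cong (∑ ys (h x) +_) (∑-swap xs ys h)) (sym (∑-+ ys (h x) _))

  -- If the weights sum to 0, every sum weighted by them vanishes.
  ∑-weight-zero : ∀ (xs : List A) (w h : A → ℕ) → ∑ xs w ≡ 0 → ∑ xs (λ x → w x * h x) ≡ 0
  ∑-weight-zero [] w h _ = refl
  ∑-weight-zero (x ∷ xs) w h ∑w≡0 = cong₂ _+_
    (cong (_* h x) (m+n≡0⇒m≡0 (w x) ∑w≡0)) (∑-weight-zero xs w h (m+n≡0⇒n≡0 (w x) ∑w≡0))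

  -- Counting and summing over the elements satisfying a Boolean predicate P.
  length-filter : ∀ (P : A → Bool) xs → length (filter (λ x → P x ≟ᵇ true) xs) ≡ ∑ xs (ind ∘ P)
  length-filter P [] = refl
  length-filter P (x ∷ xs) with P x
  ... | true = cong suc (length-filter P xs)
  ... | false = length-filter P xs

  ∑-filter : ∀ (P : A → Bool) xs h → ∑ (filter (λ x → P x ≟ᵇ true) xs) h ≡ ∑ xs (λ x → ind (P x) * h x)
  ∑-filter P [] h = refl
  ∑-filter P (x ∷ xs) h with P x
  ... | true = cong₂ _+_ (sym (+-identityʳ (h x))) (∑-filter P xs h)
  ... | false = ∑-filter P xs h

  product-2^ : ∀ (xs : List A) g → product (map (λ x → 2 ^ g x) xs) ≡ 2 ^ ∑ xs g
  product-2^ [] g = refl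
  product-2^ (x ∷ xs) g = trans (cong (2 ^ g x *_) (product-2^ xs g)) (sym (^-distribˡ-+-* 2 (g x) (∑ xs g)))

  -- AM-GM for the values 2^{g(x)}, x ranging over the elements of xs satisfying P:
  -- with m = #{x : P x},   mᵐ · 2^{∑_P g} ≤ (∑_P 2^g)ᵐ.
  am-gm-2^ : ∀ {A : Set} (xs : List A) (P : A → Bool) (g : A → ℕ) →
             let m = ∑ xs (ind ∘ P) in
             m ^ m * 2 ^ ∑ xs (λ x → ind (P x) * g x) ≤ ∑ xs (λ x → ind (P x) * 2 ^ g x) ^ m
  am-gm-2^ {A} xs P g = subst₂ _≤_
    (cong₂ _*_ (cong₂ _^_ length≡ length≡) (trans (product-2^ ys g) (cong (2 ^_) (∑-filter P xs g))))
    (cong₂ _^_ (∑-filter P xs (λ x → 2 ^ g x)) length≡)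
    (am-gm (map (λ x → 2 ^ g x) ys))
    where
    ys : List A
    ys = filter (λ x → P x ≟ᵇ true) xs
    length≡ : length (map (λ x → 2 ^ g x) ys) ≡ ∑ xs (ind ∘ P)
    length≡ = trans (length-map _ ys) (length-filter P xs)

  -- Sums over the cube {0,1}ⁿ split along the first coordinate.
  ∑-cube-suc : ∀ n (h : Input (suc n) → ℕ) →
               ∑ (allInputs (suc n)) h ≡ ∑ (allInputs n) (λ x → h (false ∷ x)) + ∑ (allInputs n) (λ x → h (true ∷ x))
  ∑-cube-suc n h = trans (∑-++ (map (false ∷_) (allInputs n)) _ h)
                         (cong₂ _+_ (∑-map (allInputs n) _ h) (∑-map (allInputs n) _ h))

  ∑-cube-1 : ∀ n → ∑ (allInputs n) (λ _ → 1) ≡ 2 ^ n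
  ∑-cube-1 zero = refl
  ∑-cube-1 (suc n) = trans (∑-cube-suc n _) (cong₂ _+_ (∑-cube-1 n) (trans (∑-cube-1 n) (sym (+-identityʳ (2 ^ n)))))

  -- Flipping a coordinate is a bijection of the cube, so it leaves sums invariant.
  ∑-cube-flip : ∀ n (i : Fin n) (h : Input n → ℕ) → ∑ (allInputs n) (λ x → h (flipAt i x)) ≡ ∑ (allInputs n) h
  ∑-cube-flip (suc n) zero h = begin
    ∑ (allInputs (suc n)) (λ x → h (flipAt zero x)) ≡⟨ ∑-cube-suc n _ ⟩
    ∑ᵢ (h ∘ (true ∷_)) + ∑ᵢ (h ∘ (false ∷_))        ≡⟨ +-comm (∑ᵢ (h ∘ (true ∷_))) _ ⟩
    ∑ᵢ (h ∘ (false ∷_)) + ∑ᵢ (h ∘ (true ∷_))        ≡⟨ sym (∑-cube-suc n h) ⟩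
    ∑ (allInputs (suc n)) h                         ∎
    where
    open ≡-Reasoning
    ∑ᵢ : (Input n → ℕ) → ℕ
    ∑ᵢ = ∑ (allInputs n)
  ∑-cube-flip (suc n) (suc i) h = begin
    ∑ (allInputs (suc n)) (λ x → h (flipAt (suc i) x))                  ≡⟨ ∑-cube-suc n _ ⟩
    ∑ᵢ (λ x → h (false ∷ flipAt i x)) + ∑ᵢ (λ x → h (true ∷ flipAt i x)) ≡⟨ cong₂ _+_ (∑-cube-flip n i (h ∘ (false ∷_)))
                                                                                     (∑-cube-flip n i (h ∘ (true ∷_))) ⟩
    ∑ᵢ (h ∘ (false ∷_)) + ∑ᵢ (h ∘ (true ∷_))                            ≡⟨ sym (∑-cube-suc n h) ⟩
    ∑ (allInputs (suc n)) h                                             ∎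
    where
    open ≡-Reasoning
    ∑ᵢ : (Input n → ℕ) → ℕ
    ∑ᵢ = ∑ (allInputs n)

  -- Flipping coordinate i changes coordinate i only, and is an involution.
  lookup-flip-same : ∀ (i : Fin n) x → lookup (flipAt i x) i ≡ not (lookup x i)
  lookup-flip-same i x = lookup∘updateAt i x

  lookup-flip-other : ∀ {i j : Fin n} x → j ≢ i → lookup (flipAt i x) j ≡ lookup x j
  lookup-flip-other {i = i} {j} x j≢i = lookup∘updateAt′ j i j≢i x

  flip-involutive : ∀ (i : Fin n) x → flipAt i (flipAt i x) ≡ x
  flip-involutive i x = trans (updateAt-updateAt i x) (updateAt-id-local i x (not-involutive (lookup x i)))

  -- Conditioning on coordinate i: if no G b depends on xᵢ, then
  --   2 ∑ₓ G (xᵢ) x = ∑ₓ G false x + ∑ₓ G true x.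
  ∑-cube-condition : ∀ (i : Fin n) (G : Bool → Input n → ℕ) → (∀ b x → G b (flipAt i x) ≡ G b x) →
                     2 * ∑ (allInputs n) (λ x → G (lookup x i) x) ≡ ∑ (allInputs n) (G false) + ∑ (allInputs n) (G true)
  ∑-cube-condition {n} i G G-flip = begin
    2 * ∑ xs Gᵢ                                                     ≡⟨ cong (∑ xs Gᵢ +_) (+-identityʳ _) ⟩
    ∑ xs Gᵢ + ∑ xs Gᵢ                                               ≡⟨ cong (∑ xs Gᵢ +_) flipped ⟩
    ∑ xs Gᵢ + ∑ xs (λ x → G (not (lookup x i)) x)                   ≡⟨ sym (∑-+ xs Gᵢ _) ⟩
    ∑ xs (λ x → G (lookup x i) x + G (not (lookup x i)) x)          ≡⟨ ∑-cong xs (λ x → both (lookup x i) x) ⟩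
    ∑ xs (λ x → G false x + G true x)                               ≡⟨ ∑-+ xs (G false) (G true) ⟩
    ∑ xs (G false) + ∑ xs (G true)                                  ∎
    where
    open ≡-Reasoning
    xs : List (Input n)
    xs = allInputs n
    Gᵢ : Input n → ℕ
    Gᵢ x = G (lookup x i) x
    flipped : ∑ xs Gᵢ ≡ ∑ xs (λ x → G (not (lookup x i)) x)
    flipped = trans (sym (∑-cube-flip n i Gᵢ))
      (∑-cong xs (λ x → trans (cong (λ b → G b (flipAt i x)) (lookup-flip-same i x)) (G-flip _ x)))
    both : ∀ b x → G b x + G (not b) x ≡ G false x + G true x
    both false x = refl
    both true x = +-comm (G true x) (G false x)

  -- Sums over all coordinates Fin n.
  ∑-allFin-suc : ∀ n (h : Fin (suc n) → ℕ) → ∑ (allFin (suc n)) h ≡ h zero + ∑ (allFin n) (h ∘ suc)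
  ∑-allFin-suc n h = cong (λ ys → h zero + sum ys)
    (trans (map-tabulate suc h) (sym (map-tabulate (λ i → i) (h ∘ suc))))

  -- Exactly one coordinate equals j.
  ∑-allFin-δ : ∀ n (j : Fin n) → ∑ (allFin n) (λ i → ind ⌊ i ≟ᶠ j ⌋) ≡ 1
  ∑-allFin-δ (suc n) zero = trans (∑-allFin-suc n (λ i → ind ⌊ i ≟ᶠ zero ⌋)) (cong suc (∑-zero (allFin n)))
  ∑-allFin-δ (suc n) (suc j) =
    trans (∑-allFin-suc n (λ i → ind ⌊ i ≟ᶠ suc j ⌋)) (trans (∑-cong (allFin n) suc≟suc) (∑-allFin-δ n j))
    where
    suc≟suc : ∀ i → ind ⌊ suc i ≟ᶠ suc j ⌋ ≡ ind ⌊ i ≟ᶠ j ⌋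
    suc≟suc i with i ≟ᶠ j
    ... | yes _ = refl
    ... | no _ = refl


-- Paths in decision trees: the fresh queries on the path of an input, sensitivity, Kraft.
module DecisionTreePaths where

  open FiniteSums
  open import Data.Bool using (Bool; true; false; if_then_else_)
  open import Data.Bool.Properties using (if-float)
  open import Data.Maybe using (Maybe; just; nothing)
  open import Data.Nat
  open import Data.Nat.Properties
  open import Data.Fin using (Fin) renaming (_≟_ to _≟ᶠ_)
  open import Data.Vec using (lookup; tabulate)
  open import Data.Vec.Properties using (lookup∘tabulate; tabulate-cong; tabulate∘lookup)
  open import Data.List using (List; []; _∷_; length; allFin)
  open import Relation.Binary.PropositionalEquality
  open import Relation.Nullary using (yes; no; contradiction)
  open import Relation.Nullary.Decidable using (⌊_⌋)

  private variable n : ℕ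

  -- A restriction fixes some coordinates to a value and leaves the others free.
  Restriction : ℕ → Set
  Restriction n = Fin n → Maybe Bool

  unrestricted : Restriction n
  unrestricted _ = nothing

  fix : Restriction n → Fin n → Bool → Restriction n
  fix ρ i b j with j ≟ᶠ i
  ... | yes _ = just b
  ... | no _ = ρ j

  fix-other : ∀ (ρ : Restriction n) {i b j} → j ≢ i → fix ρ i b j ≡ ρ j
  fix-other ρ {i} {b} {j} j≢i with j ≟ᶠ i
  ... | yes j≡i = contradiction j≡i j≢i
  ... | no _ = refl

  -- apply ρ x overwrites the coordinates fixed by ρ.
  override : Maybe Bool → Bool → Bool
  override (just b) _ = b
  override nothing c = c

  apply : Restriction n → Input n → Input n
  apply ρ x = tabulate (λ j → override (ρ j) (lookup x j))

  lookup-apply : ∀ (ρ : Restriction n) x j → lookup (apply ρ x) j ≡ override (ρ j) (lookup x j)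
  lookup-apply ρ x j = lookup∘tabulate _ j

  apply-unrestricted : ∀ (x : Input n) → apply unrestricted x ≡ x
  apply-unrestricted x = tabulate∘lookup x

  -- After fixing coordinate i, flipping it is invisible.
  apply-fix-flip : ∀ (ρ : Restriction n) i b x → apply (fix ρ i b) (flipAt i x) ≡ apply (fix ρ i b) x
  apply-fix-flip ρ i b x = tabulate-cong same
    where
    same : ∀ j → override (fix ρ i b j) (lookup (flipAt i x) j) ≡ override (fix ρ i b j) (lookup x j)
    same j with j ≟ᶠ i
    ... | yes _ = refl
    ... | no j≢i = cong (override (ρ j)) (lookup-flip-other x j≢i)

  -- Fixing a free coordinate to the value x already has does not change apply.
  apply-fix-own : ∀ (ρ : Restriction n) i x → ρ i ≡ nothing → apply (fix ρ i (lookup x i)) x ≡ apply ρ x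
  apply-fix-own ρ i x ρi≡∅ = tabulate-cong same
    where
    same : ∀ j → override (fix ρ i (lookup x i) j) (lookup x j) ≡ override (ρ j) (lookup x j)
    same j with j ≟ᶠ i
    ... | yes refl = cong (λ m → override m (lookup x j)) (sym ρi≡∅)
    ... | no _ = refl

  -- The subtree a node sends an input to, given the queried bit.
  child : Bool → DTree n → DTree n → DTree n
  child b t₀ t₁ = if b then t₁ else t₀

  child-elim : ∀ b (P : DTree n → Set) {t₀ t₁} → P t₀ → P t₁ → P (child b t₀ t₁)
  child-elim false P p₀ p₁ = p₀
  child-elim true  P p₀ p₁ = p₁

  eval-node : ∀ i (t₀ t₁ : DTree n) x → eval (node i t₀ t₁) x ≡ eval (child (lookup x i) t₀ t₁) x
  eval-node i t₀ t₁ x = sym (if-float (λ t → eval t x) (lookup x i))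

  -- The fresh queries along the path of x: the coordinates queried by t on input x that are
  -- not yet fixed, each fixed (to its value in x) once it has been queried.
  queries : DTree n → Restriction n → Input n → List (Fin n)
  queries (leaf _) ρ x = []
  queries (node i t₀ t₁) ρ x with ρ i | lookup x i
  ... | just _  | false = queries t₀ ρ x
  ... | just _  | true  = queries t₁ ρ x
  ... | nothing | false = i ∷ queries t₀ (fix ρ i false) x
  ... | nothing | true  = i ∷ queries t₁ (fix ρ i true) x

  queries-fixed : ∀ {i b} (t₀ t₁ : DTree n) {ρ} x → ρ i ≡ just b →
                  queries (node i t₀ t₁) ρ x ≡ queries (child (lookup x i) t₀ t₁) ρ x
  queries-fixed {i = i} t₀ t₁ {ρ} x ρi≡b with ρ i | lookup x i
  queries-fixed t₀ t₁ x refl | just _ | false = refl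
  queries-fixed t₀ t₁ x refl | just _ | true  = refl

  queries-free : ∀ {i} (t₀ t₁ : DTree n) {ρ} x → ρ i ≡ nothing →
                 queries (node i t₀ t₁) ρ x ≡ i ∷ queries (child (lookup x i) t₀ t₁) (fix ρ i (lookup x i)) x
  queries-free {i = i} t₀ t₁ {ρ} x ρi≡∅ with ρ i | lookup x i
  queries-free t₀ t₁ x refl | nothing | false = refl
  queries-free t₀ t₁ x refl | nothing | true  = refl

  -- Number of occurrences of i in a list of coordinates; over all i these add up to the length.
  occurrences : Fin n → List (Fin n) → ℕ
  occurrences i [] = 0
  occurrences i (j ∷ js) = ind ⌊ i ≟ᶠ j ⌋ + occurrences i js

  ∑-occurrences : ∀ (js : List (Fin n)) → ∑ (allFin n) (λ i → occurrences i js) ≡ length js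
  ∑-occurrences {n} [] = ∑-zero (allFin n)
  ∑-occurrences {n} (j ∷ js) = trans (∑-+ (allFin n) _ _) (cong₂ _+_ (∑-allFin-δ n j) (∑-occurrences js))

  occurrences-head : ∀ (i : Fin n) js → 1 ≤ occurrences i (i ∷ js)
  occurrences-head i js with i ≟ᶠ i
  ... | yes _ = s≤s z≤n
  ... | no i≢i = contradiction refl i≢i

  -- A coordinate that is free and to which t is sensitive at x is a fresh query on x's path.
  sensitive⇒queried : ∀ (t : DTree n) ρ x i → ρ i ≡ nothing → eval t x ≢ eval t (flipAt i x) →
                      1 ≤ occurrences i (queries t ρ x)
  sensitive⇒queried (leaf _) ρ x i _ differ = contradiction refl differ
  sensitive⇒queried {n} (node j t₀ t₁) ρ x i ρi≡∅ differ with j ≟ᶠ i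
  ... | yes refl = subst (λ js → 1 ≤ occurrences j js) (sym (queries-free t₀ t₁ {ρ} x ρi≡∅))
                     (occurrences-head j (queries (child (lookup x j) t₀ t₁) (fix ρ j (lookup x j)) x))
  sensitive⇒queried {n} (node j t₀ t₁) ρ x i ρi≡∅ differ | no j≢i = by-status (ρ j) refl
    where
    c : DTree n
    c = child (lookup x j) t₀ t₁
    -- x and its i-flip take the same branch at j, so they differ on that child.
    differ-child : eval c x ≢ eval c (flipAt i x)
    differ-child same = differ (begin
      eval (node j t₀ t₁) x                               ≡⟨ eval-node j t₀ t₁ x ⟩
      eval c x                                            ≡⟨ same ⟩
      eval c (flipAt i x)                                 ≡⟨ cong (λ b → eval (child b t₀ t₁) (flipAt i x))
                                                                (sym (lookup-flip-other x j≢i)) ⟩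
      eval (child (lookup (flipAt i x) j) t₀ t₁) (flipAt i x) ≡⟨ sym (eval-node j t₀ t₁ (flipAt i x)) ⟩
      eval (node j t₀ t₁) (flipAt i x)                    ∎)
      where open ≡-Reasoning
    in-child : ∀ ρ′ → ρ′ i ≡ nothing → 1 ≤ occurrences i (queries c ρ′ x)
    in-child ρ′ ρ′i≡∅ = child-elim (lookup x j)
      (λ t → ∀ ρ′ → ρ′ i ≡ nothing → eval t x ≢ eval t (flipAt i x) → 1 ≤ occurrences i (queries t ρ′ x))
      (λ ρ′ → sensitive⇒queried t₀ ρ′ x i) (λ ρ′ → sensitive⇒queried t₁ ρ′ x i) ρ′ ρ′i≡∅ differ-child
    by-status : ∀ m → ρ j ≡ m → 1 ≤ occurrences i (queries (node j t₀ t₁) ρ x)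
    by-status (just _) ρj≡b = subst (λ js → 1 ≤ occurrences i js) (sym (queries-fixed t₀ t₁ x ρj≡b))
                                (in-child ρ ρi≡∅)
    by-status nothing ρj≡∅ = subst (λ js → 1 ≤ occurrences i js) (sym (queries-free t₀ t₁ x ρj≡∅))
      (≤-trans (in-child (fix ρ j (lookup x j)) (trans (fix-other ρ (λ i≡j → j≢i (sym i≡j))) ρi≡∅))
               (m≤n+m _ _))

  -- The Kraft weight 2^{#fresh queries} of the input x made consistent with ρ.
  weight : DTree n → Restriction n → Input n → ℕ
  weight t ρ x = 2 ^ length (queries t ρ (apply ρ x))

  -- At a node querying a fixed coordinate every input takes the same branch.
  weight-fixed : ∀ {i b} (t₀ t₁ : DTree n) {ρ} x → ρ i ≡ just b →
                 weight (node i t₀ t₁) ρ x ≡ weight (child b t₀ t₁) ρ x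
  weight-fixed {i = i} t₀ t₁ {ρ} x ρi≡b = cong (λ js → 2 ^ length js)
    (trans (queries-fixed t₀ t₁ (apply ρ x) ρi≡b)
           (cong (λ c → queries (child c t₀ t₁) ρ (apply ρ x)) (trans (lookup-apply ρ x i) (cong (λ m → override m _) ρi≡b))))

  -- At a node querying a free coordinate i the weight doubles, and i becomes fixed to xᵢ.
  weight-free : ∀ {i} (t₀ t₁ : DTree n) {ρ} x → ρ i ≡ nothing →
                weight (node i t₀ t₁) ρ x ≡ 2 * weight (child (lookup x i) t₀ t₁) (fix ρ i (lookup x i)) x
  weight-free {i = i} t₀ t₁ {ρ} x ρi≡∅ = begin
    weight (node i t₀ t₁) ρ x                      ≡⟨ cong (λ js → 2 ^ length js) (queries-free t₀ t₁ (apply ρ x) ρi≡∅) ⟩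
    2 * 2 ^ length (queries (child yᵢ t₀ t₁) (fix ρ i yᵢ) (apply ρ x))
                                                   ≡⟨ cong (λ c → 2 * 2 ^ length (queries (child c t₀ t₁) (fix ρ i c) (apply ρ x))) yᵢ≡xᵢ ⟩
    2 * 2 ^ length (queries (child xᵢ t₀ t₁) (fix ρ i xᵢ) (apply ρ x))
                                                   ≡⟨ cong (λ y → 2 * 2 ^ length (queries (child xᵢ t₀ t₁) (fix ρ i xᵢ) y))
                                                           (sym (apply-fix-own ρ i x ρi≡∅)) ⟩
    2 * weight (child xᵢ t₀ t₁) (fix ρ i xᵢ) x     ∎
    where
    open ≡-Reasoning
    xᵢ yᵢ : Bool
    xᵢ = lookup x i
    yᵢ = lookup (apply ρ x) i
    yᵢ≡xᵢ : yᵢ ≡ xᵢ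
    yᵢ≡xᵢ = trans (lookup-apply ρ x i) (cong (λ m → override m xᵢ) ρi≡∅)

  -- Kraft-type bound: summing the weights over all inputs gives at most size(t)·2ⁿ
  -- (each leaf reached under ρ is reached by a 2^{-#fresh queries} fraction of inputs).
  kraft : ∀ (t : DTree n) ρ → ∑ (allInputs n) (weight t ρ) ≤ size t * 2 ^ n
  kraft {n} (leaf _) ρ = ≤-reflexive (trans (∑-cube-1 n) (sym (+-identityʳ (2 ^ n))))
  kraft {n} (node i t₀ t₁) ρ = by-status (ρ i) refl
    where
    xs : List (Input n)
    xs = allInputs n
    sizes : ℕ
    sizes = size t₀ * 2 ^ n + size t₁ * 2 ^ n
    sizes≡ : sizes ≡ (size t₀ + size t₁) * 2 ^ n
    sizes≡ = sym (*-distribʳ-+ (2 ^ n) (size t₀) (size t₁))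
    by-status : ∀ m → ρ i ≡ m → ∑ xs (weight (node i t₀ t₁) ρ) ≤ (size t₀ + size t₁) * 2 ^ n
    by-status (just b) ρi≡b = begin
      ∑ xs (weight (node i t₀ t₁) ρ)    ≡⟨ ∑-cong xs (λ x → weight-fixed t₀ t₁ x ρi≡b) ⟩
      ∑ xs (weight (child b t₀ t₁) ρ)   ≤⟨ kraft-child b ⟩
      sizes                             ≡⟨ sizes≡ ⟩
      (size t₀ + size t₁) * 2 ^ n       ∎
      where
      open ≤-Reasoning
      kraft-child : ∀ b → ∑ xs (weight (child b t₀ t₁) ρ) ≤ sizes
      kraft-child false = ≤-trans (kraft t₀ ρ) (m≤m+n _ _)
      kraft-child true  = ≤-trans (kraft t₁ ρ) (m≤n+m _ _)
    by-status nothing ρi≡∅ = begin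
      ∑ xs (weight (node i t₀ t₁) ρ)        ≡⟨ ∑-cong xs (λ x → weight-free t₀ t₁ x ρi≡∅) ⟩
      ∑ xs (λ x → 2 * G (lookup x i) x)     ≡⟨ ∑-* xs 2 (λ x → G (lookup x i) x) ⟩
      2 * ∑ xs (λ x → G (lookup x i) x)     ≡⟨ ∑-cube-condition i G G-flip ⟩
      ∑ xs (G false) + ∑ xs (G true)        ≤⟨ +-mono-≤ (kraft t₀ (fix ρ i false)) (kraft t₁ (fix ρ i true)) ⟩
      sizes                                 ≡⟨ sizes≡ ⟩
      (size t₀ + size t₁) * 2 ^ n           ∎
      where
      open ≤-Reasoning
      -- after querying the free coordinate i, continue in the b-branch with i fixed to b
      G : Bool → Input n → ℕ
      G b = weight (child b t₀ t₁) (fix ρ i b)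
      G-flip : ∀ b x → G b (flipAt i x) ≡ G b x
      G-flip b x = cong (λ y → 2 ^ length (queries (child b t₀ t₁) (fix ρ i b) y)) (apply-fix-flip ρ i b x)

  size-nonZero : ∀ (t : DTree n) → NonZero (size t)
  size-nonZero (leaf _) = _
  size-nonZero (node _ t₀ t₁) = >-nonZero (≤-trans (>-nonZero⁻¹ (size t₀) {{size-nonZero t₀}}) (m≤m+n _ _))


-- The counting argument for a fixed f : {0,1}ⁿ → {±1} (in ℕ).
module Sensitivity {n : ℕ} (f : BoolFun n) where
  open Arithmetic using (spread-bound-either; scale-bases)
  open FiniteSums
  open DecisionTreePaths
  open import Data.Bool using (Bool; true; false; not)
  open import Data.Nat
  open import Data.Nat.Properties
  open import Data.Fin using (Fin)
  open import Data.List using (List; length; allFin)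
  open import Data.Sign using (Sign) renaming (_≟_ to _≟ˢ_)
  open import Function using (_∘_)
  open import Relation.Binary.PropositionalEquality
  open import Relation.Nullary using (yes; no)
  open import Relation.Nullary.Decidable using (⌊_⌋)

  cube : List (Input n)
  cube = allInputs n

  -- f is sensitive to coordinate i at x.
  sensitive : Fin n → Input n → Bool
  sensitive i x = not ⌊ f x ≟ˢ f (flipAt i x) ⌋

  -- f(x) = σ.
  takes : Sign → Input n → Bool
  takes σ x = ⌊ f x ≟ˢ σ ⌋

  -- #{x : f(x) = σ}.
  count : Sign → ℕ
  count σ = ∑ cube (ind ∘ takes σ)

  -- Total sensitivity  C = ∑ᵢ #{x : f(x) ≠ f(x^{⊕i})} = 2ⁿ · Inf(f).
  total-sensitivity : ℕ
  total-sensitivity = ∑ (allFin n) (λ i → ∑ cube (ind ∘ sensitive i))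

  N : ℕ
  N = 2 ^ n

  -- 4·#{f = -1}·#{f = +1}, which equals N² · Var(f).
  spread : ℕ
  spread = 4 * (count Sign.- * count Sign.+)

  count-total : count Sign.- + count Sign.+ ≡ N
  count-total = trans (sym (∑-+ cube _ _)) (trans (∑-cong cube one-sign) (∑-cube-1 n))
    where
    one-sign : ∀ x → ind (takes Sign.- x) + ind (takes Sign.+ x) ≡ 1
    one-sign x with f x
    ... | Sign.- = refl
    ... | Sign.+ = refl

  -- Each sensitive edge {x, x^{⊕i}} has exactly one endpoint with value σ, so
  -- the number of i-sensitive inputs is twice the number of i-sensitive σ-inputs.
  edge-halving : ∀ σ i → ∑ cube (λ x → ind (sensitive i x)) ≡ 2 * ∑ cube (λ x → ind (takes σ x) * ind (sensitive i x))
  edge-halving σ i = begin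
    ∑ cube (λ x → ind (sensitive i x))         ≡⟨ ∑-cong cube endpoints ⟩
    ∑ cube (λ x → a x + a (flipAt i x))        ≡⟨ ∑-+ cube a (λ x → a (flipAt i x)) ⟩
    ∑ cube a + ∑ cube (λ x → a (flipAt i x))   ≡⟨ cong (∑ cube a +_) (trans (∑-cube-flip n i a) (sym (+-identityʳ _))) ⟩
    2 * ∑ cube a                               ∎
    where
    open ≡-Reasoning
    a : Input n → ℕ
    a x = ind (takes σ x) * ind (sensitive i x)
    one-endpoint : ∀ σ s t → ind (not ⌊ s ≟ˢ t ⌋)
                   ≡ ind ⌊ s ≟ˢ σ ⌋ * ind (not ⌊ s ≟ˢ t ⌋) + ind ⌊ t ≟ˢ σ ⌋ * ind (not ⌊ t ≟ˢ s ⌋)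
    one-endpoint Sign.- Sign.- Sign.- = refl
    one-endpoint Sign.- Sign.- Sign.+ = refl
    one-endpoint Sign.- Sign.+ Sign.- = refl
    one-endpoint Sign.- Sign.+ Sign.+ = refl
    one-endpoint Sign.+ Sign.- Sign.- = refl
    one-endpoint Sign.+ Sign.- Sign.+ = refl
    one-endpoint Sign.+ Sign.+ Sign.- = refl
    one-endpoint Sign.+ Sign.+ Sign.+ = refl
    endpoints : ∀ x → ind (sensitive i x) ≡ a x + a (flipAt i x)
    endpoints x rewrite flip-involutive i x = one-endpoint σ (f x) (f (flipAt i x))

  -- Number of distinct coordinates queried by T on input x.
  depth : DTree n → Input n → ℕ
  depth T x = length (queries T unrestricted x)

  -- ∑_{x : f(x) = σ} depth(x).
  depth-sum : DTree n → Sign → ℕ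
  depth-sum T σ = ∑ cube (λ x → ind (takes σ x) * depth T x)

  module _ {T : DTree n} (T-computes-f : Computes T f) where

    -- Every coordinate f is sensitive to at x is queried on x's path.
    sensitivity≤depth : ∀ x → ∑ (allFin n) (λ i → ind (sensitive i x)) ≤ depth T x
    sensitivity≤depth x = ≤-trans (∑-mono (allFin n) queried) (≤-reflexive (∑-occurrences (queries T unrestricted x)))
      where
      queried : ∀ i → ind (sensitive i x) ≤ occurrences i (queries T unrestricted x)
      queried i with f x ≟ˢ f (flipAt i x)
      ... | yes _ = z≤n
      ... | no fx≢fx′ = sensitive⇒queried T unrestricted x i refl
        (λ same → fx≢fx′ (trans (sym (T-computes-f x)) (trans same (T-computes-f (flipAt i x)))))

    -- Counting sensitive edges from their σ-endpoints:  C ≤ 2 ∑_{f(x)=σ} depth(x).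
    sensitivity≤depth-sum : ∀ σ → total-sensitivity ≤ 2 * depth-sum T σ
    sensitivity≤depth-sum σ = begin
      ∑ (allFin n) (λ i → ∑ cube (λ x → ind (sensitive i x)))               ≡⟨ ∑-cong (allFin n) (edge-halving σ) ⟩
      ∑ (allFin n) (λ i → 2 * ∑ cube (λ x → ind (takes σ x) * ind (sensitive i x)))
                                                                            ≡⟨ ∑-* (allFin n) 2 _ ⟩
      2 * ∑ (allFin n) (λ i → ∑ cube (λ x → ind (takes σ x) * ind (sensitive i x)))
                                                                            ≡⟨ cong (2 *_) (∑-swap (allFin n) cube _) ⟩
      2 * ∑ cube (λ x → ∑ (allFin n) (λ i → ind (takes σ x) * ind (sensitive i x)))
                                                                            ≡⟨ cong (2 *_) (∑-cong cube (λ x → ∑-* (allFin n) (ind (takes σ x)) _)) ⟩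
      2 * ∑ cube (λ x → ind (takes σ x) * ∑ (allFin n) (λ i → ind (sensitive i x)))
                                                                            ≤⟨ *-monoʳ-≤ 2 (∑-mono cube (λ x → *-monoʳ-≤ (ind (takes σ x)) (sensitivity≤depth x))) ⟩
      2 * depth-sum T σ                                                     ∎
      where open ≤-Reasoning

    -- A constant function has no sensitive edges.
    constant⇒insensitive : ∀ σ → count σ ≡ 0 → total-sensitivity ≡ 0
    constant⇒insensitive σ none = n≤0⇒n≡0 (≤-trans (sensitivity≤depth-sum σ)
      (≤-reflexive (cong (2 *_) (∑-weight-zero cube (λ x → ind (takes σ x)) (depth T) none))))

  -- AM-GM over the σ-inputs plus Kraft: with M = #{f = σ} and A = ∑_{f(x)=σ} depth(x),
  --   Mᴹ 2ᴬ ≤ (size(T) 2ⁿ)ᴹ,  i.e. the average depth over σ-inputs is ≤ log(size·2ⁿ/M).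
  depth-entropy : ∀ T σ → count σ ^ count σ * 2 ^ depth-sum T σ ≤ (size T * 2 ^ n) ^ count σ
  depth-entropy T σ = ≤-trans (am-gm-2^ cube (takes σ) (depth T)) (^-monoˡ-≤ (count σ) (begin
    ∑ cube (λ x → ind (takes σ x) * 2 ^ depth T x) ≤⟨ ∑-mono cube (λ x → drop-weight (takes σ x) (2 ^ depth T x)) ⟩
    ∑ cube (λ x → 2 ^ depth T x)                   ≡⟨ ∑-cong cube (λ x → cong (λ y → 2 ^ length (queries T unrestricted y))
                                                                           (sym (apply-unrestricted x))) ⟩
    ∑ cube (weight T unrestricted)                 ≤⟨ kraft T unrestricted ⟩
    size T * 2 ^ n                                 ∎))
    where
    open ≤-Reasoning
    drop-weight : ∀ b h → ind b * h ≤ h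
    drop-weight true h = ≤-reflexive (+-identityʳ h)
    drop-weight false h = z≤n

  -- The theorem in integer form:  2^{CN} · spreadˢᵖʳᵉᵃᵈ ≤ (4 size(T) N²)ˢᵖʳᵉᵃᵈ, i.e.
  -- 2^{Inf/Var} ≤ 4 size(T)/Var.  Both signs satisfy the hypotheses of spread-bound-either.
  integer-form : ∀ {T} → Computes T f →
                 2 ^ (total-sensitivity * N) * spread ^ spread ≤ (4 * (size T * (N * N))) ^ spread
  integer-form {T} T-computes-f = scale-bases 4 {total-sensitivity * N} {spread} {M * P} {size T * (N * N)}
    (spread-bound-either {M} {P} {N} {size T} {depth-sum T Sign.-} {depth-sum T Sign.+} {total-sensitivity}
      {{size-nonZero T}} count-total
      (sensitivity≤depth-sum {T} T-computes-f Sign.-) (depth-entropy T Sign.-)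
      (sensitivity≤depth-sum {T} T-computes-f Sign.+) (depth-entropy T Sign.+))
    where
    M P : ℕ
    M = count Sign.-
    P = count Sign.+


-- The embedding ι : ℕ → ℚ, and the integer criterion for r ≤ log₂ Y.
module RationalEmbedding where

  open FiniteSums using (∑)
  open import Data.List using (List; []; _∷_; map)
  open import Data.Nat as ℕ using (ℕ; zero; suc)
  import Data.Nat.Properties as ℕ
  open import Data.Integer as ℤ using (ℤ; +_; -[1+_])
  import Data.Integer.Properties as ℤ
  open import Data.Rational using (ℚ; mkℚ; ↥_; _/_; _+_; _*_; _÷_; 1/_; _≤_; *≤*; 1ℚ; toℚᵘ; NonZero; Positive; NonNegative)
  open import Data.Rational.Properties
  import Data.Rational.Unnormalised as ℚᵘ
  import Data.Rational.Unnormalised.Properties as ℚᵘ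
  open import Data.Nat.Coprimality using (1-coprimeTo) renaming (sym to coprime-sym)
  open import Relation.Binary.PropositionalEquality
  open import Relation.Nullary using (contradiction)
  open import Data.Rational.Solver using (module +-*-Solver)
  open +-*-Solver using (solve; _:*_; _:=_)

  -- The embedding ℕ → ℚ.
  ι : ℕ → ℚ
  ι a = (+ a) / 1

  ι-normal : ∀ a → ι a ≡ mkℚ (+ a) 0 (coprime-sym (1-coprimeTo a))
  ι-normal a = ↥p/↧p≡p (mkℚ (+ a) 0 (coprime-sym (1-coprimeTo a)))

  ι-+ : ∀ a b → ι a + ι b ≡ ι (a ℕ.+ b)
  ι-+ a b = trans (cong₂ _+_ (ι-normal a) (ι-normal b))
    (cong (_/ 1) (trans (cong₂ ℤ._+_ (ℤ.*-identityʳ (+ a)) (ℤ.*-identityʳ (+ b))) (sym (ℤ.pos-+ a b))))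

  ι-* : ∀ a b → ι a * ι b ≡ ι (a ℕ.* b)
  ι-* a b = trans (cong₂ _*_ (ι-normal a) (ι-normal b)) (cong (_/ 1) (sym (ℤ.pos-* a b)))

  -- Multiplying the fraction a/N by N gives back a.
  /-*-cancel : ∀ a N .{{_ : ℕ.NonZero N}} → ((+ a) / N) * ι N ≡ ι a
  /-*-cancel a N@(suc N-1) = toℚᵘ-injective (begin
    toℚᵘ ((+ a) / N * ι N)                         ≈⟨ toℚᵘ-homo-* ((+ a) / N) (ι N) ⟩
    toℚᵘ ((+ a) / N) ℚᵘ.* toℚᵘ (ι N)               ≈⟨ ℚᵘ.*-cong (toℚᵘ-fromℚᵘ (ℚᵘ.mkℚᵘ (+ a) N-1)) (toℚᵘ-fromℚᵘ (ℚᵘ.mkℚᵘ (+ N) 0)) ⟩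
    ℚᵘ.mkℚᵘ (+ a) N-1 ℚᵘ.* ℚᵘ.mkℚᵘ (+ N) 0         ≈⟨ ℚᵘ.*≡* cross ⟩
    ℚᵘ.mkℚᵘ (+ a) 0                                ≈⟨ ℚᵘ.≃-sym (toℚᵘ-fromℚᵘ (ℚᵘ.mkℚᵘ (+ a) 0)) ⟩
    toℚᵘ (ι a)                                     ∎)
    where
    open ℚᵘ.≃-Reasoning
    cross : (+ a ℤ.* + N) ℤ.* + 1 ≡ + a ℤ.* + (N ℕ.* 1)
    cross = trans (ℤ.*-identityʳ _) (cong (λ m → + a ℤ.* + m) (sym (ℕ.*-identityʳ N)))

  ι-injective : ∀ {a b} → ι a ≡ ι b → a ≡ b
  ι-injective {a} {b} ιa≡ιb = ℤ.+-injective (cong ↥_ (trans (sym (ι-normal a)) (trans ιa≡ιb (ι-normal b))))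

  ι-mono : ∀ {a b} → a ℕ.≤ b → ι a ≤ ι b
  ι-mono {a} {b} a≤b rewrite ι-normal a | ι-normal b =
    *≤* (subst₂ ℤ._≤_ (ℤ.pos-* a 1) (ℤ.pos-* b 1) (ℤ.+≤+ (ℕ.*-monoˡ-≤ 1 a≤b)))

  ι-nonNeg : ∀ a → NonNegative (ι a)
  ι-nonNeg a = normalize-nonNeg a 1

  ι-pos : ∀ a .{{_ : ℕ.NonZero a}} → Positive (ι a)
  ι-pos a = normalize-pos a 1

  ι-^ : ∀ a q → ι (a ℕ.^ q) ≡ ι a ^ℚ q
  ι-^ a zero = refl
  ι-^ a (suc q) = trans (sym (ι-* a (a ℕ.^ q))) (cong (ι a *_) (ι-^ a q))

  ^ℚ-distrib-* : ∀ x y q → (x * y) ^ℚ q ≡ x ^ℚ q * y ^ℚ q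
  ^ℚ-distrib-* x y zero = refl
  ^ℚ-distrib-* x y (suc q) = trans (cong (x * y *_) (^ℚ-distrib-* x y q)) (interchange x y (x ^ℚ q) (y ^ℚ q))
    where
    interchange : ∀ a b c d → a * b * (c * d) ≡ a * c * (b * d)
    interchange = solve 4 (λ a b c d → a :* b :* (c :* d) := a :* c :* (b :* d)) refl

  -- Criterion for  r ≤ log₂ Y  in integer terms.  If r = a/E and Y = G/E (E > 0), then r ≥ 0, and
  -- for r = p/q in lowest terms (so pE = qa) the defining inequality 2ᵖ ≤ Y^q is 2ᵖ E^q ≤ G^q.
  ≤log₂-intro : ∀ r Y {a E G} .{{_ : ℕ.NonZero E}} → r * ι E ≡ ι a → Y * ι E ≡ ι G →
                (∀ p q → p ℕ.* E ≡ q ℕ.* a → 2 ℕ.^ p ℕ.* E ℕ.^ q ℕ.≤ G ℕ.^ q) → r ≤log₂ Y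
  ≤log₂-intro r@(mkℚ -[1+ _ ] _ _) Y {a} {E} rE≡a _ _ =
    contradiction (sym rE≡a) (nonNeg≢neg (ι a) (r * ι E) {{ι-nonNeg a}} {{neg*pos⇒neg r (ι E) {{ι-pos E}}}})
  ≤log₂-intro r@(mkℚ (+ p) q-1 _) Y {a} {E} {G} rE≡a YE≡G integral = *-cancelʳ-≤-pos (ι E ^ℚ q) {{Eᵠ-pos}} (begin
    ι (2 ℕ.^ p) * ι E ^ℚ q         ≡⟨ cong (ι (2 ℕ.^ p) *_) (sym (ι-^ E q)) ⟩
    ι (2 ℕ.^ p) * ι (E ℕ.^ q)      ≡⟨ ι-* (2 ℕ.^ p) (E ℕ.^ q) ⟩
    ι (2 ℕ.^ p ℕ.* E ℕ.^ q)        ≤⟨ ι-mono (integral p q pE≡qa) ⟩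
    ι (G ℕ.^ q)                    ≡⟨ ι-^ G q ⟩
    ι G ^ℚ q                       ≡⟨ cong (_^ℚ q) (sym YE≡G) ⟩
    (Y * ι E) ^ℚ q                 ≡⟨ ^ℚ-distrib-* Y (ι E) q ⟩
    Y ^ℚ q * ι E ^ℚ q              ∎)
    where
    open ≤-Reasoning
    q : ℕ
    q = suc q-1
    Eᵠ-pos : Positive (ι E ^ℚ q)
    Eᵠ-pos = subst Positive (ι-^ E q) (ι-pos (E ℕ.^ q) {{ℕ.m^n≢0 E q}})
    rq≡p : r * ι q ≡ ι p
    rq≡p = trans (cong (_* ι q) (sym (↥p/↧p≡p r))) (/-*-cancel p q)
    pE≡qa : p ℕ.* E ≡ q ℕ.* a
    pE≡qa = ι-injective (begin-equality
      ι (p ℕ.* E)        ≡⟨ sym (ι-* p E) ⟩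
      ι p * ι E          ≡⟨ cong (_* ι E) (sym rq≡p) ⟩
      r * ι q * ι E      ≡⟨ swap r (ι q) (ι E) ⟩
      ι q * (r * ι E)    ≡⟨ cong (ι q *_) rE≡a ⟩
      ι q * ι a          ≡⟨ ι-* q a ⟩
      ι (q ℕ.* a)        ∎)
      where
      swap : ∀ x y z → x * y * z ≡ y * (x * z)
      swap = solve 3 (λ x y z → x :* y :* z := y :* (x :* z)) refl

  -- Cancelling a positive natural factor.
  *-cancelʳ-ι : ∀ {x y} N .{{_ : ℕ.NonZero N}} → x * ι N ≡ y * ι N → x ≡ y
  *-cancelʳ-ι N xN≡yN = ≤-antisym (*-cancelʳ-≤-pos (ι N) {{ι-pos N}} (≤-reflexive xN≡yN))
                                  (*-cancelʳ-≤-pos (ι N) {{ι-pos N}} (≤-reflexive (sym xN≡yN)))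

  -- (x / v) · (v z) = x z.
  ÷-*-cancel : ∀ x v z .{{_ : NonZero v}} → (x ÷ v) * (v * z) ≡ x * z
  ÷-*-cancel x v z = begin-equality
    x * 1/ v * (v * z)   ≡⟨ regroup x (1/ v) v z ⟩
    x * (1/ v * v) * z   ≡⟨ cong (λ w → x * w * z) (*-inverseˡ v) ⟩
    x * 1ℚ * z           ≡⟨ cong (_* z) (*-identityʳ x) ⟩
    x * z                ∎
    where
    open ≤-Reasoning
    regroup : ∀ a b c d → a * b * (c * d) ≡ a * (b * c) * d
    regroup = solve 4 (λ a b c d → a :* b :* (c :* d) := a :* (b :* c) :* d) refl

  -- Finite sums commute with the embedding after scaling by N.
  sumℚ-scaled : ∀ {A : Set} (xs : List A) (h : A → ℚ) (c : A → ℕ) N →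
                (∀ x → h x * ι N ≡ ι (c x)) → sumℚ (map h xs) * ι N ≡ ι (∑ xs c)
  sumℚ-scaled [] h c N _ = *-zeroˡ (ι N)
  sumℚ-scaled (x ∷ xs) h c N scaled = trans (*-distribʳ-+ (ι N) (h x) _)
    (trans (cong₂ _+_ (scaled x) (sumℚ-scaled xs h c N scaled)) (ι-+ (c x) _))


-- Pr, Inf and Var of f, multiplied by powers of N = 2ⁿ, are the integers counted above.
module Scaled {n : ℕ} (f : BoolFun n) where
  open FiniteSums using (∑; ind; length-filter)
  open RationalEmbedding
  open Sensitivity f
  import Data.Nat as ℕ
  import Data.Nat.Properties as ℕ
  open import Data.Integer using (+_)
  open import Data.Rational using (ℚ; 0ℚ; _÷_; _/_; NonZero; _*_)
  import Data.Rational.Properties as ℚ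
  open import Data.Rational.Solver using (module +-*-Solver)
  open +-*-Solver using (solve; _:*_; _:=_)
  open import Data.Bool using (Bool)
  open import Data.List using (allFin)
  open import Data.Sign using (Sign)
  open import Data.Sum using (_⊎_; inj₁; inj₂)
  open import Relation.Binary.PropositionalEquality

  instance
    N≢0 : ℕ.NonZero N
    N≢0 = ℕ.m^n≢0 2 n

  Pr-scaled : ∀ (P : Input n → Bool) → Pr P * ι N ≡ ι (∑ cube (λ x → ind (P x)))
  Pr-scaled P = trans (cong (_* ι N) (cong (λ k → (+ k) / N) (length-filter P cube)))
                      (/-*-cancel (∑ cube (λ x → ind (P x))) N)

  Inf-scaled : Inf f * ι N ≡ ι total-sensitivity
  Inf-scaled = sumℚ-scaled (allFin n) _ _ N (λ i → Pr-scaled (sensitive i))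

  Var-scaled : Var f * ι (N ℕ.* N) ≡ ι spread
  Var-scaled = begin
    ι 4 * (X * Z) * ι (N ℕ.* N)   ≡⟨ cong (ι 4 * (X * Z) *_) (sym (ι-* N N)) ⟩
    ι 4 * (X * Z) * (ι N * ι N)   ≡⟨ regroup (ι 4) X Z (ι N) ⟩
    ι 4 * ((X * ι N) * (Z * ι N)) ≡⟨ cong₂ (λ a b → ι 4 * (a * b)) (Pr-scaled _) (Pr-scaled _) ⟩
    ι 4 * (ι (count Sign.-) * ι (count Sign.+)) ≡⟨ cong (ι 4 *_) (ι-* (count Sign.-) (count Sign.+)) ⟩
    ι 4 * ι (count Sign.- ℕ.* count Sign.+)     ≡⟨ ι-* 4 (count Sign.- ℕ.* count Sign.+) ⟩
    ι spread                                    ∎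
    where
    open ≡-Reasoning
    X Z : ℚ
    X = Pr (takes Sign.-)
    Z = Pr (takes Sign.+)
    regroup : ∀ a x z m → a * (x * z) * (m * m) ≡ a * ((x * m) * (z * m))
    regroup = solve 4 (λ a x z m → a :* (x :* z) :* (m :* m) := a :* ((x :* m) :* (z :* m))) refl

  ÷Var-scaled : ∀ x .{{_ : NonZero (Var f)}} → (x ÷ Var f) * ι spread ≡ x * ι (N ℕ.* N)
  ÷Var-scaled x = trans (cong ((x ÷ Var f) *_) (sym Var-scaled)) (÷-*-cancel x (Var f) (ι (N ℕ.* N)))

  Var≢0⇒spread≢0 : NonZero (Var f) → ℕ.NonZero spread
  Var≢0⇒spread≢0 Var≢0 = ℕ.≢-nonZero (λ spread≡0 → ℕ.NonZero.nonZero (subst NonZero (Var≡0 spread≡0) Var≢0))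
    where
    Var≡0 : spread ≡ 0 → Var f ≡ 0ℚ
    Var≡0 spread≡0 = *-cancelʳ-ι (N ℕ.* N) {{ℕ.m*n≢0 N N}}
      (trans Var-scaled (trans (cong ι spread≡0) (sym (ℚ.*-zeroˡ (ι (N ℕ.* N))))))

  -- The two ratios in the theorem, scaled by N²·Var(f).
  Inf÷Var-scaled : .{{_ : NonZero (Var f)}} → (Inf f ÷ Var f) * ι spread ≡ ι (total-sensitivity ℕ.* N)
  Inf÷Var-scaled = begin
    (Inf f ÷ Var f) * ι spread   ≡⟨ ÷Var-scaled (Inf f) ⟩
    Inf f * ι (N ℕ.* N)          ≡⟨ cong (Inf f *_) (sym (ι-* N N)) ⟩
    Inf f * (ι N * ι N)          ≡⟨ sym (ℚ.*-assoc (Inf f) (ι N) (ι N)) ⟩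
    Inf f * ι N * ι N            ≡⟨ cong (_* ι N) Inf-scaled ⟩
    ι total-sensitivity * ι N    ≡⟨ ι-* total-sensitivity N ⟩
    ι (total-sensitivity ℕ.* N)  ∎
    where open ≡-Reasoning

  ι÷Var-scaled : ∀ a b .{{_ : NonZero (Var f)}} → ((ι a * ι b) ÷ Var f) * ι spread ≡ ι (a ℕ.* (b ℕ.* (N ℕ.* N)))
  ι÷Var-scaled a b = trans (÷Var-scaled (ι a * ι b))
    (trans (ℚ.*-assoc (ι a) (ι b) _) (trans (cong (ι a *_) (ι-* b (N ℕ.* N))) (ι-* a _)))

  -- Var(f) = 0 means f is constant, so it has no sensitive edges and Inf(f) = 0.
  Var≡0⇒Inf≡0 : ∀ {T} → Computes T f → Var f ≡ 0ℚ → Inf f ≡ 0ℚ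
  Var≡0⇒Inf≡0 {T} T-computes-f Var≡0 = *-cancelʳ-ι N (trans Inf-scaled
    (trans (cong ι (constant (ℕ.m*n≡0⇒m≡0∨n≡0 4 spread≡0))) (sym (ℚ.*-zeroˡ (ι N)))))
    where
    spread≡0 : spread ≡ 0
    spread≡0 = ι-injective (trans (sym Var-scaled) (trans (cong (_* ι (N ℕ.* N)) Var≡0) (ℚ.*-zeroˡ (ι (N ℕ.* N)))))
    constant : 4 ≡ 0 ⊎ count Sign.- ℕ.* count Sign.+ ≡ 0 → total-sensitivity ≡ 0
    constant (inj₁ ())
    constant (inj₂ MP≡0) with ℕ.m*n≡0⇒m≡0∨n≡0 (count Sign.-) MP≡0
    ... | inj₁ M≡0 = constant⇒insensitive {T} T-computes-f Sign.- M≡0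
    ... | inj₂ P≡0 = constant⇒insensitive {T} T-computes-f Sign.+ P≡0


open import Data.Integer using (+_)
open import Data.Rational using (0ℚ; _≤_; _÷_; _/_; NonZero; _*_)
open import Data.Product using (_×_; _,_)
open import Relation.Binary.PropositionalEquality using (_≡_)
import Data.Nat as ℕ
open import Data.Rational.Properties using (≤-reflexive)
open Arithmetic using (exponent-rescale)
open RationalEmbedding using (ι; ≤log₂-intro)

lemma5p5 : (n : ℕ) (f : BoolFun n) (T : DTree n) → Computes T f →
    (Var f ≡ 0ℚ → Inf f ≤ 0ℚ) ×
    ((nz : NonZero (Var f)) →
      (Inf f ÷ Var f) {{nz}} ≤log₂ ((((+ 4) / 1) * ((+ size T) / 1)) ÷ Var f) {{nz}})
-- If Var = 0 then Inf = 0; otherwise reduce to the integer form of the theorem.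
lemma5p5 n f T T-computes-f = (λ Var≡0 → ≤-reflexive (Var≡0⇒Inf≡0 {T} T-computes-f Var≡0)) , bound
  where
  open Sensitivity f
  open Scaled f
  -- Inf/Var = CN/spread and 4s/Var = 4sN²/spread, so by ≤log₂-intro it suffices that
  -- 2ᵖ spread^q ≤ (4sN²)^q whenever p/q = CN/spread: the integer form, rescaled.
  bound : (nz : NonZero (Var f)) → (Inf f ÷ Var f) {{nz}} ≤log₂ ((ι 4 * ι (size T)) ÷ Var f) {{nz}}
  bound nz = ≤log₂-intro (Inf f ÷ Var f) ((ι 4 * ι (size T)) ÷ Var f)
    {total-sensitivity ℕ.* N} {spread} {4 ℕ.* (size T ℕ.* (N ℕ.* N))}
    Inf÷Var-scaled (ι÷Var-scaled 4 (size T))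
    (λ p q pE≡qCN → exponent-rescale p q pE≡qCN (integer-form {T} T-computes-f))
    where
    instance
      Var≢0 : NonZero (Var f)
      Var≢0 = nz
      spread≢0 : ℕ.NonZero spread
      spread≢0 = Var≢0⇒spread≢0 nz
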